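{- Let $n\ge 5$ be odd and let $x,y$ be adjacent vertices of $Q_n$ with $f_n(x)+f_n(y)=\operatorname{str}_{f_n}(Q_n)$. If $x$ and $y$ both begin with the bit $1$, then $$\operatorname{str}_{f_n}(Q_n)\le \operatorname{str}_{f_{n-2}}(Q_{n-2})+3\cdot 2^{n-2}+\binom{n-3}{\lceil (n-3)/2\rceil}+\binom{n-2}{\lceil (n-2)/2\rceil}.$$
   Context: $Q_n$ is the $n$-dimensional hypercube: vertices are the $n$-bit strings, adjacent iff they differ in exactly one position. For a bijection $f:V(G)\to\{1,\dots,|V(G)|\}$, $\operatorname{str}_f(G)=\max\{f(u)+f(v):uv\in E(G)\}$. An $n$-bit string is $x_1\cdots x_n$, $x_i\in\{0,1\}$; its weight is its number of $1$s. Lexicographic order: $x<y$ if for some $k$, $x_j=y_j$ for $j<k$ and $x_k<y_k$. $S_n^i$ is the sequence of $n$-bit strings of weight $i$ in increasing lexicographic order; $R_n^i$ is the same set in decreasing lexicographic order. $S_n$ is the concatenation $(R_n^1,R_n^3,\dots,R_n^{n-1},S_n^n,S_n^{n-2},\dots,S_n^2,S_n^0)$ for even $n$ and $(R_n^1,R_n^3,\dots,R_n^{n-2},R_n^n,S_n^{n-1},\dots,S_n^2,S_n^0)$ for odd $n$; $f_n$ maps the string in position $j$ of $S_n$ to $j$. -}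

module Defs where

open import Data.Bool.Base using (Bool; true; false)
import Data.Bool.Properties as Bool
open import Data.Empty using (⊥)
open import Data.Fin.Base using (toℕ)
open import Data.List.Base using (List; []; _∷_; _++_; map; filter; concatMap; reverse; upTo; cartesianProduct; cartesianProductWith)
open import Data.List.Extrema.Nat using (max)
open import Data.List.Membership.Propositional using (_∈_; lose)
open import Data.List.Membership.Propositional.Properties using (∈-cartesianProductWith⁺; ∈-concatMap⁺; ∈-filter⁺; ∈-upTo⁺; ∈-++⁺ˡ; ∈-++⁺ʳ)
open import Data.List.Relation.Binary.Permutation.Propositional using (↭-sym)
open import Data.List.Relation.Binary.Permutation.Propositional.Properties using (∈-resp-↭)
open import Data.List.Relation.Unary.Any using (here; there; index)
open import Data.List.Relation.Unary.Any.Properties using (reverse⁺)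
import Data.List.Sort as Sort
open import Data.Nat.Base using (ℕ; zero; suc; _+_; s≤s)
open import Data.Nat.Divisibility using (_∣_; _∣?_)
open import Data.Nat.Properties using (_≟_)
open import Data.Product.Base using (_×_; uncurry)
open import Data.Vec.Base using (Vec; []; _∷_; count; zip)
import Data.Vec.Properties as Vec
import Data.Vec.Relation.Binary.Lex.Strict as Lex
open import Relation.Binary.Bundles using (DecTotalOrder)
import Relation.Binary.Construct.Flip.EqAndOrd as Flip
open import Relation.Binary.PropositionalEquality using (_≡_; refl)
open import Relation.Nullary.Decidable using (Dec; yes; no; ¬?)
open import Relation.Nullary.Negation using (¬_)

BitString : ℕ → Set
BitString n = Vec Bool n

BeginsWith : ∀ {n} → Bool → BitString n → Set
BeginsWith b []      = ⊥
BeginsWith b (c ∷ _) = c ≡ b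

weight : ∀ {n} → BitString n → ℕ
weight = count (Bool._≟ true)

bitStrings : ∀ n → List (BitString n)
bitStrings zero    = [] ∷ []
bitStrings (suc n) = cartesianProductWith _∷_ (false ∷ true ∷ []) (bitStrings n)

∈-bitStrings : ∀ {n} (x : BitString n) → x ∈ bitStrings n
∈-bitStrings []      = here refl
∈-bitStrings (b ∷ x) = ∈-cartesianProductWith⁺ _∷_ (∈-bits b) (∈-bitStrings x)
  where
  ∈-bits : ∀ c → c ∈ false ∷ true ∷ []
  ∈-bits false = here refl
  ∈-bits true  = there (here refl)

hammingDistance : ∀ {n} → BitString n → BitString n → ℕ
hammingDistance x y = count (uncurry λ a b → ¬? (a Bool.≟ b)) (zip x y)

-- Adjacency in the hypercube Qₙ.
Adjacent : ∀ {n} → BitString n → BitString n → Set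
Adjacent x y = hammingDistance x y ≡ 1

adjacent? : ∀ {n} (xy : BitString n × BitString n) → Dec (uncurry Adjacent xy)
adjacent? = uncurry λ x y → hammingDistance x y ≟ 1

-- Each edge of Qₙ is listed in both orientations.
edges : ∀ n → List (BitString n × BitString n)
edges n = filter adjacent? (cartesianProduct (bitStrings n) (bitStrings n))

-- str_f(Qₙ).  The default 0 is attained only for the edgeless Q₀ or when
-- f vanishes on every edge, so it never matters for a numbering by 1, …, 2ⁿ
-- with n ≥ 1.
str : ∀ {n} → (BitString n → ℕ) → ℕ
str {n} f = max 0 (map (uncurry λ x y → f x + f y) (edges n))

lexOrder : ℕ → DecTotalOrder _ _ _
lexOrder = Lex.≤-decTotalOrder Bool.<-strictTotalOrder

ofWeight : ∀ n → ℕ → List (BitString n)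
ofWeight n i = filter (λ x → weight x ≟ i) (bitStrings n)

-- Sₙⁱ
increasing : ∀ n → ℕ → List (BitString n)
increasing n i = Sort.sort (lexOrder n) (ofWeight n i)

-- Rₙⁱ
decreasing : ∀ n → ℕ → List (BitString n)
decreasing n i = Sort.sort (Flip.decTotalOrder (lexOrder n)) (ofWeight n i)

Odd : ℕ → Set
Odd n = ¬ (2 ∣ n)

odd? : ∀ n → Dec (Odd n)
odd? n = ¬? (2 ∣? n)

oddsUpTo : ℕ → List ℕ
oddsUpTo n = filter odd? (upTo (suc n))

evensDownFrom : ℕ → List ℕ
evensDownFrom n = reverse (filter (2 ∣?_) (upTo (suc n)))

-- Sₙ, for both parities of n: the Rₙⁱ with i ≤ n odd, i ascending, followed by
-- the Sₙⁱ with i ≤ n even, i descending.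
sequence : ∀ n → List (BitString n)
sequence n = concatMap (decreasing n) (oddsUpTo n) ++ concatMap (increasing n) (evensDownFrom n)

∈-sequence : ∀ {n} (x : BitString n) → x ∈ sequence n
∈-sequence {n} x with 2 ∣? weight x
... | no odd = ∈-++⁺ˡ (∈-concatMap⁺ (decreasing n) (lose i∈ x∈))
  where
  i∈ : weight x ∈ oddsUpTo n
  i∈ = ∈-filter⁺ odd? (∈-upTo⁺ (s≤s (Vec.count≤n (Bool._≟ true) x))) odd
  x∈ : x ∈ decreasing n (weight x)
  x∈ = ∈-resp-↭ (↭-sym (Sort.sort-↭ (Flip.decTotalOrder (lexOrder n)) _)) (∈-filter⁺ (λ y → weight y ≟ weight x) (∈-bitStrings x) refl)
... | yes even = ∈-++⁺ʳ _ (∈-concatMap⁺ (increasing n) (lose i∈ x∈))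
  where
  i∈ : weight x ∈ evensDownFrom n
  i∈ = reverse⁺ (∈-filter⁺ (2 ∣?_) (∈-upTo⁺ (s≤s (Vec.count≤n (Bool._≟ true) x))) even)
  x∈ : x ∈ increasing n (weight x)
  x∈ = ∈-resp-↭ (↭-sym (Sort.sort-↭ (lexOrder n) _)) (∈-filter⁺ (λ y → weight y ≟ weight x) (∈-bitStrings x) refl)

-- fₙ: the position, counted from 1, of x in Sₙ.
f : ∀ n → BitString n → ℕ
f n x = suc (toℕ (index (∈-sequence x)))

{-# OPTIONS --safe #-}
module Submission where

-- Each string is numbered by a sum of every second binomial coefficient plus
-- its rank among the strings of its weight.  The alternating sums telescope, so
-- for an edge bu, bv of Qₙ where v is u with a 1 replaced by 0 and bu has odd weight,
--   f (bu) + f (bv) = 2ⁿ + 2 + above u + below v,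
-- where above and below count the strings of equal weight that are
-- lexicographically larger and smaller.  Deleting a common first bit lowers
-- above u + below v by a single binomial coefficient of the next lower row,
-- hence by at most the central one.  Two such steps, followed by prefixing a bit
-- of the right parity, lead from an edge of Qₙ to an edge of Qₙ₋₂.  Edges whose
-- end of odd weight is the lower one do not matter: if both ends begin with 1,
-- the sum is at most 2ⁿ.

open import Defs
open import Data.Bool.Base using (Bool; true; false; f<t)
import Data.Bool.Properties as Bool
open import Data.Fin.Base using (toℕ)
open import Data.List.Base using (List; []; _∷_; _++_; _∷ʳ_; [_]; map; filter; concatMap; reverse; upTo; length)
open import Data.List.Extrema.Nat using (xs≤max)
open import Data.List.Membership.Propositional using (_∈_)
open import Data.List.Membership.Propositional.Properties using (∈-concatMap⁻; ∈-filter⁻; ∈-filter⁺; ∈-cartesianProduct⁺; ∈-map⁺; ∈-++⁺ʳ)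
open import Data.List.Membership.Propositional.Properties.WithK using (unique⇒irrelevant)
open import Data.List.Properties using (++-assoc; ++-identityʳ; concatMap-++; filter-++; filter-accept; filter-none; filter-reject; filter-≐; length-++; length-map; length-reverse; map-++; reverse-++; unfold-reverse; upTo-∷ʳ)
open import Data.List.Relation.Binary.Disjoint.Propositional using (Disjoint)
import Data.List.Relation.Binary.Permutation.Homogeneous as Homogeneous
open import Data.List.Relation.Binary.Permutation.Propositional using (_↭_; ↭⇒↭ₛ; ↭-refl; ↭-sym; ↭-trans)
open import Data.List.Relation.Binary.Permutation.Propositional.Properties using (↭-reverse; ↭-length; ∈-resp-↭; All-resp-↭) renaming (map⁺ to ↭-map⁺)
import Data.List.Relation.Binary.Permutation.Setoid.Properties as Permutation
import Data.List.Relation.Binary.Pointwise as Pointwise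
open import Data.List.Relation.Unary.All as All using (All; []; _∷_)
import Data.List.Relation.Unary.All.Properties as All
open import Data.List.Relation.Unary.AllPairs as AllPairs using (AllPairs; []; _∷_)
import Data.List.Relation.Unary.AllPairs.Properties as AllPairs
open import Data.List.Relation.Unary.Any using (here; index)
open import Data.List.Relation.Unary.Sorted.TotalOrder.Properties using (AllPairs⇒Sorted; ↗↭↗⇒≋)
open import Data.List.Relation.Unary.Unique.Propositional using (Unique)
import Data.List.Relation.Unary.Unique.Propositional.Properties as Unique
import Data.List.Sort as Sort
open import Data.Nat.Base
open import Data.Nat.Combinatorics using (_C_; nCk+nC[k+1]≡[n+1]C[k+1]; nCk≡nC[n∸k]; k>n⇒nCk≡0)
open import Data.Nat.Divisibility using (_∣_; _∣?_; ∣m+n∣m⇒∣n; ∣1⇒≡1; _∣0; ∣m∣n⇒∣m+n; ∣-refl)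
open import Data.Nat.ListAction using (sum)
open import Data.Nat.ListAction.Properties using (sum-++; sum-↭)
open import Data.Nat.Properties
open import Data.Nat.Tactic.RingSolver using (solve-∀)
open import Data.Product.Base using (_×_; _,_; proj₁; proj₂; ∃; uncurry)
open import Data.Sum.Base using (_⊎_; inj₁; inj₂) renaming (map to map⊎)
open import Data.Vec.Base using ([]; _∷_; replicate)
open import Data.Vec.Properties using (count≤n; ∷-injective)
open import Data.Vec.Relation.Binary.Lex.Strict using (this; next)
import Data.Vec.Relation.Binary.Pointwise.Inductive as VecPointwise
open import Function.Base using (_∘_; flip)
open import Relation.Binary.Bundles using (DecTotalOrder)
import Relation.Binary.Construct.Flip.EqAndOrd as Flip
open import Relation.Binary.PropositionalEquality using (_≡_; _≢_; refl; sym; trans; cong; cong₂; subst; subst₂; setoid; module ≡-Reasoning)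
open import Relation.Nullary using (¬_; yes; no; contradiction)
open import Relation.Unary using (Pred; Decidable)

-- Binomial coefficients

-- n C⁻ k is the binomial coefficient with lower index k − 1, so that the
-- Pascal rule needs no case distinction on k.
_C⁻_ : ℕ → ℕ → ℕ
n C⁻ zero  = 0
n C⁻ suc k = n C k

pascal : ∀ n k → suc n C k ≡ n C k + n C⁻ k
pascal n zero    = refl
pascal n (suc k) = trans (sym (nCk+nC[k+1]≡[n+1]C[k+1] n k)) (+-comm (n C k) _)

-- Pascal's rule gives both sides the common term `n C suc k`, leaving entries k and k + 2 of the
-- previous row to compare: two ascents, or equality by symmetry when that row is 2k + 2.
nCk≤nC[1+k] : ∀ n k → k + k < n → n C k ≤ n C suc k
nCk≤nC[1+k] (suc n) zero    _ = begin
  1                ≤⟨ m≤n+m 1 (n C 1) ⟩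
  n C 1 + n C 0    ≡⟨ pascal n 1 ⟨
  suc n C 1        ∎
  where open ≤-Reasoning
nCk≤nC[1+k] (suc n) (suc k) (s≤s 2k+2≤n) = begin
  suc n C suc k                 ≡⟨ pascal n (suc k) ⟩
  n C suc k + n C k             ≤⟨ +-monoʳ-≤ (n C suc k) outer ⟩
  n C suc k + n C suc (suc k)   ≡⟨ +-comm (n C suc k) _ ⟩
  n C suc (suc k) + n C suc k   ≡⟨ pascal n (suc (suc k)) ⟨
  suc n C suc (suc k)           ∎
  where
  open ≤-Reasoning
  outer : n C k ≤ n C suc (suc k)
  outer with m≤n⇒m<n∨m≡n 2k+2≤n
  ... | inj₁ 2k+2<n = ≤-trans
    (nCk≤nC[1+k] n k (≤-trans (s≤s (+-mono-≤ (n≤1+n k) (n≤1+n k))) 2k+2<n))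
    (nCk≤nC[1+k] n (suc k) 2k+2<n)
  ... | inj₂ refl = ≤-reflexive (trans (nCk≡nC[n∸k] (≤-trans (n≤1+n k) (m≤m+n _ _))) (cong (n C_) reflected))
    where
    reflected : suc k + suc k ∸ k ≡ suc (suc k)
    reflected = trans (cong (_∸ k) (+-suc (suc k) k)) (m+n∸n≡m (suc (suc k)) k)

nC-mono-below-centre : ∀ n {j h} → j ≤′ h → h ≤ ⌈ n /2⌉ → n C j ≤ n C h
nC-mono-below-centre n ≤′-refl                   _  = ≤-refl
nC-mono-below-centre n {h = suc h} (≤′-step j≤h) h< =
  ≤-trans (nC-mono-below-centre n j≤h (<⇒≤ h<)) (nCk≤nC[1+k] n h 2h<n)
  where
  open ≤-Reasoning
  -- The two halves of n are used separately: h ≤ ⌊n/2⌋ and h + 1 ≤ ⌈n/2⌉.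
  2h<n : h + h < n
  2h<n = begin
    suc (h + h)          ≡⟨ +-suc h h ⟨
    h + suc h            ≤⟨ +-mono-≤ (≤-pred (≤-trans h< (⌊n/2⌋-mono (n≤1+n (suc n))))) h< ⟩
    ⌊ n /2⌋ + ⌈ n /2⌉    ≡⟨ ⌊n/2⌋+⌈n/2⌉≡n n ⟩
    n                    ∎

nCk≤nC⌈n/2⌉ : ∀ n k → n C k ≤ n C ⌈ n /2⌉
nCk≤nC⌈n/2⌉ n k with ≤-total k ⌈ n /2⌉ | k ≤? n
... | inj₁ k≤h | _       = nC-mono-below-centre n (≤⇒≤′ k≤h) ≤-refl
... | inj₂ h≤k | no k≰n  = ≤-trans (≤-reflexive (k>n⇒nCk≡0 (≰⇒> k≰n))) z≤n
... | inj₂ h≤k | yes k≤n = begin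
  n C k          ≡⟨ nCk≡nC[n∸k] k≤n ⟩
  n C (n ∸ k)    ≤⟨ nC-mono-below-centre n (≤⇒≤′ n∸k≤h) ≤-refl ⟩
  n C ⌈ n /2⌉    ∎
  where
  open ≤-Reasoning
  n∸k≤h : n ∸ k ≤ ⌈ n /2⌉
  n∸k≤h = begin
    n ∸ k                            ≤⟨ ∸-monoʳ-≤ n h≤k ⟩
    n ∸ ⌈ n /2⌉                      ≡⟨ cong (_∸ ⌈ n /2⌉) (⌊n/2⌋+⌈n/2⌉≡n n) ⟨
    ⌊ n /2⌋ + ⌈ n /2⌉ ∸ ⌈ n /2⌉      ≡⟨ m+n∸n≡m ⌊ n /2⌋ ⌈ n /2⌉ ⟩
    ⌊ n /2⌋                          ≤⟨ ⌊n/2⌋≤⌈n/2⌉ n ⟩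
    ⌈ n /2⌉                          ∎

binomialSum : ℕ → ℕ → ℕ
binomialSum n zero    = 0
binomialSum n (suc k) = binomialSum n k + n C k

binomialSum-pascal : ∀ n k → binomialSum (suc n) (suc k) ≡ binomialSum n (suc k) + binomialSum n k
binomialSum-pascal n zero    = refl
binomialSum-pascal n (suc k) = begin
  binomialSum (suc n) (suc k) + suc n C suc k
    ≡⟨ cong₂ _+_ (binomialSum-pascal n k) (pascal n (suc k)) ⟩
  (binomialSum n (suc k) + binomialSum n k) + (n C suc k + n C k)
    ≡⟨ interchange (binomialSum n (suc k)) (binomialSum n k) (n C suc k) (n C k) ⟩
  binomialSum n (suc (suc k)) + binomialSum n (suc k) ∎
  where
  open ≡-Reasoning
  interchange : ∀ a b c d → (a + b) + (c + d) ≡ (a + c) + (b + d)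
  interchange = solve-∀

binomialSum-full : ∀ n {k} → n < k → binomialSum n k ≡ 2 ^ n
binomialSum-full zero {suc zero}    _ = refl
binomialSum-full zero {suc (suc k)} _ =
  cong₂ _+_ (binomialSum-full zero {suc k} (s≤s z≤n)) (k>n⇒nCk≡0 {0} {suc k} (s≤s z≤n))
binomialSum-full (suc n) {suc k} (s≤s n<k) = begin
  binomialSum (suc n) (suc k)                ≡⟨ binomialSum-pascal n k ⟩
  binomialSum n (suc k) + binomialSum n k    ≡⟨ cong₂ _+_ (binomialSum-full n (m<n⇒m<1+n n<k)) (binomialSum-full n n<k) ⟩
  2 ^ n + 2 ^ n                              ≡⟨ cong (2 ^ n +_) (+-identityʳ (2 ^ n)) ⟨
  2 ^ suc n                                  ∎
  where open ≡-Reasoning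

-- Parity and sums of every second binomial coefficient

2∣-step : ∀ k → ¬ 2 ∣ k → 2 ∣ suc k
2∣-step zero          ¬2∣0 = contradiction (2 ∣0) ¬2∣0
2∣-step (suc zero)    _    = ∣-refl
2∣-step (suc (suc k)) ¬2∣  = ∣m∣n⇒∣m+n ∣-refl (2∣-step k (¬2∣ ∘ ∣m∣n⇒∣m+n ∣-refl))

2∣⇒odd-suc : ∀ {k} → 2 ∣ k → Odd (suc k)
2∣⇒odd-suc {k} 2∣k 2∣1+k with ∣1⇒≡1 (∣m+n∣m⇒∣n (subst (2 ∣_) (+-comm 1 k) 2∣1+k) 2∣k)
... | ()

-- By the Pascal rule, the sum of every second entry of row m + 1 telescopes
-- to a sum of consecutive entries of row m.
module AlternatingSum
  {p} {P : Pred ℕ p} (P? : Decidable P)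
  (P-suc⇒¬P : ∀ {k} → P (suc k) → ¬ P k) (¬P-suc⇒P : ∀ {k} → ¬ P (suc k) → P k)
  where

  partialSum : ℕ → ℕ → ℕ
  partialSum n w = sum (map (n C_) (filter P? (upTo w)))

  private
    unsnoc : ∀ n w → partialSum n (suc w) ≡ partialSum n w + sum (map (n C_) (filter P? [ w ]))
    unsnoc n w = begin
      partialSum n (suc w)
        ≡⟨ cong (λ l → sum (map (n C_) (filter P? l))) (upTo-∷ʳ w) ⟨
      sum (map (n C_) (filter P? (upTo w ++ [ w ])))
        ≡⟨ cong (sum ∘ map (n C_)) (filter-++ P? (upTo w) [ w ]) ⟩
      sum (map (n C_) (filter P? (upTo w) ++ filter P? [ w ]))
        ≡⟨ cong sum (map-++ (n C_) (filter P? (upTo w)) _) ⟩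
      sum (map (n C_) (filter P? (upTo w)) ++ map (n C_) (filter P? [ w ]))
        ≡⟨ sum-++ (map (n C_) (filter P? (upTo w))) _ ⟩
      partialSum n w + sum (map (n C_) (filter P? [ w ])) ∎
      where open ≡-Reasoning

  partialSum-accept : ∀ n {w} → P w → partialSum n (suc w) ≡ partialSum n w + n C w
  partialSum-accept n {w} Pw = trans (unsnoc n w) (cong (partialSum n w +_)
    (trans (cong (sum ∘ map (n C_)) (filter-accept P? {xs = []} Pw)) (+-identityʳ (n C w))))

  partialSum-reject : ∀ n {w} → ¬ P w → partialSum n (suc w) ≡ partialSum n w
  partialSum-reject n {w} ¬Pw = trans (unsnoc n w) (trans (cong (partialSum n w +_)
    (cong (sum ∘ map (n C_)) (filter-reject P? {xs = []} ¬Pw))) (+-identityʳ (partialSum n w)))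

  -- Each selected entry `suc m C k` splits into the entries k - 1 and k of row m, so the selected
  -- ones tile that row without gaps. The clauses are proved together because rejection at `suc w`
  -- is acceptance at `w`.
  partialSum≡binomialSum : ∀ m w →
    (¬ P w → partialSum (suc m) w ≡ binomialSum m w) ×
    (P w → partialSum (suc m) (suc w) ≡ binomialSum m (suc w))
  partialSum≡binomialSum m zero    = (λ _ → refl) , partialSum-accept (suc m)
  partialSum≡binomialSum m (suc w) = (λ ¬Psw → proj₂ IH (¬P-suc⇒P ¬Psw)) , accept
    where
    open ≡-Reasoning
    IH = partialSum≡binomialSum m w
    accept : P (suc w) → partialSum (suc m) (suc (suc w)) ≡ binomialSum m (suc (suc w))
    accept Psw = begin
      partialSum (suc m) (suc (suc w))              ≡⟨ partialSum-accept (suc m) Psw ⟩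
      partialSum (suc m) (suc w) + suc m C suc w    ≡⟨ cong₂ _+_ (trans (partialSum-reject (suc m) (P-suc⇒¬P Psw)) (proj₁ IH (P-suc⇒¬P Psw))) (sym (nCk+nC[k+1]≡[n+1]C[k+1] m w)) ⟩
      binomialSum m w + (m C w + m C suc w)         ≡⟨ +-assoc (binomialSum m w) _ _ ⟨
      binomialSum m (suc (suc w))                   ∎

  -- Strings of length m + 1 split evenly by the parity of their weight: the telescoped sum covers
  -- all of row m whether or not `suc m` is selected.
  partialSum-full : ∀ m → partialSum (suc m) (suc (suc m)) ≡ 2 ^ m
  partialSum-full m with P? (suc m)
  ... | yes P1+m = trans (proj₂ (partialSum≡binomialSum m (suc m)) P1+m) (binomialSum-full m (n≤1+n (suc m)))
  ... | no ¬P1+m = trans (partialSum-reject (suc m) ¬P1+m) (trans (proj₁ (partialSum≡binomialSum m (suc m)) ¬P1+m) (binomialSum-full m ≤-refl))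

odd-suc⇒2∣ : ∀ k → Odd (suc k) → 2 ∣ k
odd-suc⇒2∣ k odd-1+k with 2 ∣? k
... | yes 2∣k = 2∣k
... | no ¬2∣k = contradiction (2∣-step k ¬2∣k) odd-1+k

module OddSum  = AlternatingSum odd? (λ odd-1+k odd-k → odd-1+k (2∣-step _ odd-k)) (λ ¬odd-1+k 2∣k → ¬odd-1+k (2∣⇒odd-suc 2∣k))
module EvenSum = AlternatingSum (2 ∣?_) (λ 2∣1+k 2∣k → 2∣⇒odd-suc 2∣k 2∣1+k) (odd-suc⇒2∣ _)

-- Positions in lists

-- Both counts are kept so that reversing a list merely swaps them; the rank in a decreasing block
-- is then read off from the increasing one.
record Split {a} {A : Set a} (x : A) (xs : List A) (i j : ℕ) : Set a where
  constructor split
  field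
    before after  : List A
    decomposition : xs ≡ before ++ x ∷ after
    length-before : length before ≡ i
    length-after  : length after ≡ j

split-length : ∀ {a} {A : Set a} {x : A} {xs i j} → Split x xs i j → suc (i + j) ≡ length xs
split-length (split bs as refl refl refl) = trans (sym (+-suc (length bs) (length as))) (sym (length-++ bs))

split-++ˡ : ∀ {a} {A : Set a} {x : A} {xs i j} ys → Split x xs i j → Split x (xs ++ ys) i (j + length ys)
split-++ˡ {x = x} ys (split bs as refl refl refl) =
  split bs (as ++ ys) (++-assoc bs (x ∷ as) ys) refl (length-++ as)

split-++ʳ : ∀ {a} {A : Set a} {x : A} xs {ys i j} → Split x ys i j → Split x (xs ++ ys) (length xs + i) j
split-++ʳ {x = x} xs (split bs as refl refl refl) =
  split (xs ++ bs) as (sym (++-assoc xs bs (x ∷ as))) (length-++ xs) refl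

split-map : ∀ {a b} {A : Set a} {B : Set b} {x : A} (g : A → B) {xs i j} → Split x xs i j → Split (g x) (map g xs) i j
split-map {x = x} g (split bs as refl refl refl) =
  split (map g bs) (map g as) (map-++ g bs (x ∷ as)) (length-map g bs) (length-map g as)

reverse-++-∷ : ∀ {a} {A : Set a} (bs : List A) x as → reverse (bs ++ x ∷ as) ≡ reverse as ++ x ∷ reverse bs
reverse-++-∷ bs x as = begin
  reverse (bs ++ x ∷ as)              ≡⟨ reverse-++ bs (x ∷ as) ⟩
  reverse (x ∷ as) ++ reverse bs      ≡⟨ cong (_++ reverse bs) (unfold-reverse x as) ⟩
  (reverse as ∷ʳ x) ++ reverse bs     ≡⟨ ++-assoc (reverse as) [ x ] (reverse bs) ⟩
  reverse as ++ x ∷ reverse bs        ∎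
  where open ≡-Reasoning

split-reverse : ∀ {a} {A : Set a} {x : A} {xs i j} → Split x xs i j → Split x (reverse xs) j i
split-reverse {x = x} (split bs as refl refl refl) =
  split (reverse as) (reverse bs) (reverse-++-∷ bs x as) (length-reverse as) (length-reverse bs)

split-concatMap : ∀ {a b} {A : Set a} {B : Set b} (g : A → List B) {x i j} bs c {as cs} → cs ≡ bs ++ c ∷ as → Split x (g c) i j →
  Split x (concatMap g cs) (length (concatMap g bs) + i) (j + length (concatMap g as))
split-concatMap g bs c {as} refl s =
  subst (λ l → Split _ l _ _) (sym (concatMap-++ g bs (c ∷ as))) (split-++ʳ (concatMap g bs) (split-++ˡ (concatMap g as) s))

-- `f` takes the index of a membership proof that passes through sorting permutations. In a
-- duplicate-free list all membership proofs coincide, so it may be replaced by the one read off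
-- from the decomposition.
index-split : ∀ {a} {A : Set a} {x : A} {xs i j} → Unique xs → (x∈xs : x ∈ xs) → Split x xs i j → toℕ (index x∈xs) ≡ i
index-split unique x∈xs (split bs as refl refl refl) =
  trans (cong (toℕ ∘ index) (unique⇒irrelevant unique x∈xs (∈-++⁺ʳ bs (here refl)))) (index-∈-++⁺ʳ bs)
  where
  index-∈-++⁺ʳ : ∀ bs → toℕ (index (∈-++⁺ʳ bs (here refl))) ≡ length bs
  index-∈-++⁺ʳ []       = refl
  index-∈-++⁺ʳ (_ ∷ bs) = cong suc (index-∈-++⁺ʳ bs)

filter-map : ∀ {a b p} {A : Set a} {B : Set b} {P : Pred B p} (P? : Decidable P) (g : A → B) xs →
  filter P? (map g xs) ≡ map g (filter (P? ∘ g) xs)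
filter-map P? g []       = refl
filter-map P? g (x ∷ xs) with P? (g x)
... | yes _ = cong (g x ∷_) (filter-map P? g xs)
... | no _  = filter-map P? g xs

length-concatMap : ∀ {a b} {A : Set a} {B : Set b} (g : A → List B) {h : A → ℕ} →
  (∀ x → length (g x) ≡ h x) → ∀ xs → length (concatMap g xs) ≡ sum (map h xs)
length-concatMap g eq []       = refl
length-concatMap g eq (x ∷ xs) = trans (length-++ (g x)) (cong₂ _+_ (eq x) (length-concatMap g eq xs))

reverse-AllPairs : ∀ {a ℓ} {A : Set a} {R : A → A → Set ℓ} {xs} → AllPairs R xs → AllPairs (flip R) (reverse xs)
reverse-AllPairs {xs = []}     []       = []
reverse-AllPairs {R = R} {xs = x ∷ xs} (Rx ∷ Rxs) = subst (AllPairs (flip R)) (sym (unfold-reverse x xs))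
  (AllPairs.++⁺ (reverse-AllPairs Rxs) ([] ∷ []) (All.map (_∷ []) (All-resp-↭ (↭-sym (↭-reverse xs)) Rx)))

Unique-resp-↭ : ∀ {a} {A : Set a} {xs ys : List A} → xs ↭ ys → Unique xs → Unique ys
Unique-resp-↭ = Permutation.Unique-resp-↭ (setoid _) ∘ ↭⇒↭ₛ

-- Sorting is never unfolded: two sorted rearrangements of one list agree, so exhibiting a sorted
-- one determines the result.
sort-unique : ∀ {a ℓ₁ ℓ₂} (O : DecTotalOrder a ℓ₁ ℓ₂) →
  (∀ {x y} → DecTotalOrder._≈_ O x y → x ≡ y) →
  ∀ {xs ys} → AllPairs (DecTotalOrder._≤_ O) ys → xs ↭ ys → Sort.sort O xs ≡ ys
sort-unique O ≈⇒≡ {xs} {ys} ys↗ xs↭ys = Pointwise.Pointwise-≡⇒≡ (Pointwise.map ≈⇒≡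
  (↗↭↗⇒≋ totalOrder (Sort.sort-↗ O xs) (AllPairs⇒Sorted totalOrder ys↗)
    (Homogeneous.map Eq.reflexive (↭⇒↭ₛ (↭-trans (Sort.sort-↭ O xs) xs↭ys)))))
  where open DecTotalOrder O using (totalOrder; module Eq)

upTo-prefix : ∀ {v n} → v ≤′ n → ∃ λ rest → upTo n ≡ upTo v ++ rest
upTo-prefix {v} ≤′-refl = [] , sym (++-identityʳ (upTo v))
upTo-prefix {v} {suc n} (≤′-step v≤n) with upTo-prefix v≤n
... | rest , eq = rest ∷ʳ n , trans (sym (upTo-∷ʳ n)) (trans (cong (_∷ʳ n) eq) (++-assoc (upTo v) rest [ n ]))

-- Isolates the block of weight `v` among the blocks of one parity; the prefix is exactly the list
-- over which `partialSum` sums.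
filter-upTo : ∀ {p} {P : Pred ℕ p} (P? : Decidable P) {v n} → P v → v ≤ n →
  ∃ λ rest → filter P? (upTo (suc n)) ≡ filter P? (upTo v) ++ v ∷ rest
filter-upTo P? {v} {n} Pv v≤n with upTo-prefix (s≤′s (≤⇒≤′ v≤n))
... | rest , eq = filter P? rest , (begin
  filter P? (upTo (suc n))                     ≡⟨ cong (filter P?) (trans eq (cong (_++ rest) (sym (upTo-∷ʳ v)))) ⟩
  filter P? ((upTo v ∷ʳ v) ++ rest)            ≡⟨ cong (filter P?) (++-assoc (upTo v) [ v ] rest) ⟩
  filter P? (upTo v ++ v ∷ rest)               ≡⟨ filter-++ P? (upTo v) (v ∷ rest) ⟩
  filter P? (upTo v) ++ filter P? (v ∷ rest)   ≡⟨ cong (filter P? (upTo v) ++_) (filter-accept P? Pv) ⟩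
  filter P? (upTo v) ++ v ∷ filter P? rest     ∎)
  where open ≡-Reasoning

-- Ranks among the strings of a given weight

bitStrings-suc : ∀ n → bitStrings (suc n) ≡ map (false ∷_) (bitStrings n) ++ map (true ∷_) (bitStrings n)
bitStrings-suc n = cong (map (false ∷_) (bitStrings n) ++_) (++-identityʳ _)

bitStrings-sorted : ∀ n → AllPairs (DecTotalOrder._≤_ (lexOrder n)) (bitStrings n)
bitStrings-sorted zero    = [] ∷ []
bitStrings-sorted (suc n) = subst (AllPairs _) (sym (bitStrings-suc n)) (AllPairs.++⁺
  (AllPairs.map⁺ (AllPairs.map (next refl) (bitStrings-sorted n)))
  (AllPairs.map⁺ (AllPairs.map (next refl) (bitStrings-sorted n)))
  (All.map⁺ (All.universal (λ _ → All.map⁺ (All.universal (λ _ → this f<t refl) _)) _)))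

increasing≡ofWeight : ∀ n i → increasing n i ≡ ofWeight n i
increasing≡ofWeight n i = sort-unique (lexOrder n) VecPointwise.Pointwise-≡⇒≡
  (AllPairs.filter⁺ (λ x → weight x ≟ i) (bitStrings-sorted n)) ↭-refl

decreasing≡reverse-ofWeight : ∀ n i → decreasing n i ≡ reverse (ofWeight n i)
decreasing≡reverse-ofWeight n i = sort-unique (Flip.decTotalOrder (lexOrder n)) VecPointwise.Pointwise-≡⇒≡
  (reverse-AllPairs (AllPairs.filter⁺ (λ x → weight x ≟ i) (bitStrings-sorted n))) (↭-sym (↭-reverse (ofWeight n i)))

ofWeight⁻ : ∀ n → ℕ → List (BitString n)
ofWeight⁻ n zero    = []
ofWeight⁻ n (suc k) = ofWeight n k

-- Pascal's rule for lists, in lexicographic order: strings with leading 0 precede those with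
-- leading 1.
ofWeight-suc : ∀ n k → ofWeight (suc n) k ≡ map (false ∷_) (ofWeight n k) ++ map (true ∷_) (ofWeight⁻ n k)
ofWeight-suc n k = begin
  ofWeight (suc n) k
    ≡⟨ cong (filter weight?) (bitStrings-suc n) ⟩
  filter weight? (map (false ∷_) (bitStrings n) ++ map (true ∷_) (bitStrings n))
    ≡⟨ filter-++ weight? (map (false ∷_) (bitStrings n)) _ ⟩
  filter weight? (map (false ∷_) (bitStrings n)) ++ filter weight? (map (true ∷_) (bitStrings n))
    ≡⟨ cong₂ _++_ (filter-map weight? (false ∷_) (bitStrings n)) (trans (filter-map weight? (true ∷_) (bitStrings n)) (cong (map (true ∷_)) (leading k))) ⟩
  map (false ∷_) (ofWeight n k) ++ map (true ∷_) (ofWeight⁻ n k) ∎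
  where
  open ≡-Reasoning
  weight? : Decidable (λ (x : BitString (suc n)) → weight x ≡ k)
  weight? x = weight x ≟ k
  leading : ∀ k → filter (λ x → suc (weight x) ≟ k) (bitStrings n) ≡ ofWeight⁻ n k
  leading zero    = filter-none (λ x → suc (weight x) ≟ zero) (All.universal (λ _ ()) (bitStrings n))
  leading (suc k) = filter-≐ (λ x → suc (weight x) ≟ suc k) (λ x → weight x ≟ k) (suc-injective , cong suc) (bitStrings n)

length-ofWeight  : ∀ n k → length (ofWeight n k) ≡ n C k
length-ofWeight⁻ : ∀ n k → length (ofWeight⁻ n k) ≡ n C⁻ k
length-ofWeight zero    zero    = refl
length-ofWeight zero    (suc k) = sym (k>n⇒nCk≡0 {0} {suc k} (s≤s z≤n))
length-ofWeight (suc n) k = begin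
  length (ofWeight (suc n) k)                                                            ≡⟨ cong length (ofWeight-suc n k) ⟩
  length (map (false ∷_) (ofWeight n k) ++ map (true ∷_) (ofWeight⁻ n k))                ≡⟨ length-++ (map (false ∷_) (ofWeight n k)) ⟩
  length (map (false ∷_) (ofWeight n k)) + length (map (true ∷_) (ofWeight⁻ n k))        ≡⟨ cong₂ _+_ (trans (length-map (false ∷_) (ofWeight n k)) (length-ofWeight n k)) (trans (length-map (true ∷_) (ofWeight⁻ n k)) (length-ofWeight⁻ n k)) ⟩
  n C k + n C⁻ k                                                                         ≡⟨ pascal n k ⟨
  suc n C k                                                                              ∎
  where open ≡-Reasoning
length-ofWeight⁻ n zero    = refl
length-ofWeight⁻ n (suc k) = length-ofWeight n k

-- The number of strings of the same length and weight that are
-- lexicographically smaller (below) or larger (above).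
below : ∀ {n} → BitString n → ℕ
below []                  = 0
below         (false ∷ x) = below x
below {suc n} (true ∷ x)  = n C suc (weight x) + below x

above : ∀ {n} → BitString n → ℕ
above []                  = 0
above {suc n} (false ∷ x) = above x + n C⁻ weight x
above         (true ∷ x)  = above x

-- After a string with leading 0 come all those of its weight with leading 1; before a string with
-- leading 1 come all those with leading 0. These are the binomial terms in `above` and `below`.
split-ofWeight : ∀ {n} (x : BitString n) → Split x (ofWeight n (weight x)) (below x) (above x)
split-ofWeight [] = split [] [] refl refl refl
split-ofWeight {suc n} (false ∷ x) = subst₂ (λ l j → Split (false ∷ x) l (below x) (above x + j))
  (sym (ofWeight-suc n (weight x)))
  (trans (length-map (true ∷_) (ofWeight⁻ n (weight x))) (length-ofWeight⁻ n (weight x)))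
  (split-++ˡ (map (true ∷_) (ofWeight⁻ n (weight x))) (split-map (false ∷_) (split-ofWeight x)))
split-ofWeight {suc n} (true ∷ x) = subst₂ (λ l i → Split (true ∷ x) l (i + below x) (above x))
  (sym (ofWeight-suc n (suc (weight x))))
  (trans (length-map (false ∷_) (ofWeight n (suc (weight x)))) (length-ofWeight n (suc (weight x))))
  (split-++ʳ (map (false ∷_) (ofWeight n (suc (weight x)))) (split-map (true ∷_) (split-ofWeight x)))

suc[below+above]≡nC[weight] : ∀ {n} (x : BitString n) → suc (below x + above x) ≡ n C weight x
suc[below+above]≡nC[weight] {n} x = trans (split-length (split-ofWeight x)) (length-ofWeight n (weight x))

∈-ofWeight⇒weight : ∀ {n i} {x : BitString n} → x ∈ ofWeight n i → weight x ≡ i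
∈-ofWeight⇒weight {n} {i} x∈ = proj₂ (∈-filter⁻ (λ x → weight x ≟ i) {xs = bitStrings n} x∈)

-- Distinctness of the entries of Sₙ and closed forms for the numbering

ofWeight-unique : ∀ n i → Unique (ofWeight n i)
ofWeight-unique n i = Unique.filter⁺ (λ x → weight x ≟ i) (bitStrings-unique n)
  where
  bitStrings-unique : ∀ n → Unique (bitStrings n)
  bitStrings-unique zero    = [] ∷ []
  bitStrings-unique (suc n) =
    Unique.cartesianProductWith⁺ _∷_ ∷-injective (((λ ()) ∷ []) ∷ [] ∷ []) (bitStrings-unique n)

-- Blocks of different weights cannot overlap. Allowing any rearrangement `g` covers the decreasing
-- and the increasing blocks alike.
concatMap-ofWeight-unique : ∀ {n} {g : ℕ → List (BitString n)} → (∀ i → g i ↭ ofWeight n i) →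
  ∀ {is} → Unique is → Unique (concatMap g is)
concatMap-ofWeight-unique {n} {g} g↭ is! = Unique.concat⁺
  (All.map⁺ (All.universal (λ i → Unique-resp-↭ (↭-sym (g↭ i)) (ofWeight-unique n i)) _))
  (AllPairs.map⁺ (AllPairs.map disjoint is!))
  where
  disjoint : ∀ {i j} → i ≢ j → Disjoint (g i) (g j)
  disjoint i≢j (x∈i , x∈j) = i≢j (trans
    (sym (∈-ofWeight⇒weight (∈-resp-↭ (g↭ _) x∈i))) (∈-ofWeight⇒weight (∈-resp-↭ (g↭ _) x∈j)))

∈-concatMap-ofWeight : ∀ {n p} {g : ℕ → List (BitString n)} → (∀ i → g i ↭ ofWeight n i) →
  {P : Pred ℕ p} → ∀ {is} → All P is → ∀ {x} → x ∈ concatMap g is → P (weight x)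
∈-concatMap-ofWeight {g = g} g↭ {P} {is} Pis {x} x∈ = All.lookupWith
  (λ {i} Pi x∈gi → subst P (sym (∈-ofWeight⇒weight (∈-resp-↭ (g↭ i) x∈gi))) Pi)
  Pis (∈-concatMap⁻ g {xs = is} x∈)

decreasing-↭ : ∀ n i → decreasing n i ↭ ofWeight n i
decreasing-↭ n i = Sort.sort-↭ (Flip.decTotalOrder (lexOrder n)) (ofWeight n i)

increasing-↭ : ∀ n i → increasing n i ↭ ofWeight n i
increasing-↭ n i = Sort.sort-↭ (lexOrder n) (ofWeight n i)

sequence-unique : ∀ n → Unique (sequence n)
sequence-unique n = Unique.++⁺
  (concatMap-ofWeight-unique (decreasing-↭ n) (Unique.filter⁺ odd? (Unique.upTo⁺ (suc n))))
  (concatMap-ofWeight-unique (increasing-↭ n) (Unique-resp-↭ (↭-sym (↭-reverse _)) (Unique.filter⁺ (2 ∣?_) (Unique.upTo⁺ (suc n)))))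
  (λ (x∈odds , x∈evens) →
    ∈-concatMap-ofWeight (decreasing-↭ n) (All.all-filter odd? (upTo (suc n))) x∈odds
      (∈-concatMap-ofWeight (increasing-↭ n) (All-resp-↭ (↭-sym (↭-reverse _)) (All.all-filter (2 ∣?_) (upTo (suc n)))) x∈evens))

length-decreasing : ∀ n i → length (decreasing n i) ≡ n C i
length-decreasing n i = trans (↭-length (decreasing-↭ n i)) (length-ofWeight n i)

length-increasing : ∀ n i → length (increasing n i) ≡ n C i
length-increasing n i = trans (↭-length (increasing-↭ n i)) (length-ofWeight n i)

-- Before x stand the blocks of smaller odd weight, whose sizes telescope to `binomialSum m u`, and,
-- its own block being decreasing, the larger strings of its weight. The outer `suc` counts from 1.
f-odd : ∀ {m u} (x : BitString (suc m)) → weight x ≡ suc u → 2 ∣ u → f (suc m) x ≡ suc (binomialSum m u + above x)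
f-odd {m} {u} x wx≡ 2∣u with filter-upTo odd? (subst Odd (sym wx≡) (2∣⇒odd-suc 2∣u)) (count≤n (Bool._≟ true) x)
... | rest , eq = cong suc (trans (index-split (sequence-unique (suc m)) (∈-sequence x) position) (cong (_+ above x) (begin
  length (concatMap (decreasing (suc m)) (filter odd? (upTo (weight x))))   ≡⟨ length-concatMap (decreasing (suc m)) (length-decreasing (suc m)) (filter odd? (upTo (weight x))) ⟩
  OddSum.partialSum (suc m) (weight x)                                      ≡⟨ cong (OddSum.partialSum (suc m)) wx≡ ⟩
  OddSum.partialSum (suc m) (suc u)                                         ≡⟨ OddSum.partialSum-reject (suc m) (λ odd-u → odd-u 2∣u) ⟩
  OddSum.partialSum (suc m) u                                               ≡⟨ proj₁ (OddSum.partialSum≡binomialSum m u) (λ odd-u → odd-u 2∣u) ⟩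
  binomialSum m u                                                           ∎)))
  where
  open ≡-Reasoning
  position : Split x (sequence (suc m)) (length (concatMap (decreasing (suc m)) (filter odd? (upTo (weight x)))) + above x) _
  position = split-++ˡ (concatMap (increasing (suc m)) (evensDownFrom (suc m)))
    (split-concatMap (decreasing (suc m)) (filter odd? (upTo (weight x))) (weight x) eq
      (subst (λ l → Split x l (above x) (below x)) (sym (decreasing≡reverse-ofWeight (suc m) (weight x)))
        (split-reverse (split-ofWeight x))))

-- Before y stand all 2ᵐ strings of odd weight, those of larger even weight and the smaller ones of
-- its own weight. The added `binomialSum` counts the strings of even weight at most that of y; it
-- completes the even half and avoids subtraction.
f-even : ∀ {m} (y : BitString (suc m)) → 2 ∣ weight y →
  f (suc m) y + binomialSum m (suc (weight y)) ≡ suc (2 ^ suc m + below y)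
f-even {m} y 2∣v with filter-upTo (2 ∣?_) 2∣v (count≤n (Bool._≟ true) y)
... | rest , eq = begin
  f (suc m) y + B                          ≡⟨ cong (λ i → suc i + B) (index-split (sequence-unique (suc m)) (∈-sequence y) position) ⟩
  suc (odds + (later + below y) + B)       ≡⟨ cong suc (shuffle odds later (below y) B) ⟩
  suc (odds + (B + later) + below y)       ≡⟨ cong (λ t → suc (t + below y)) (cong₂ _+_ odds≡ later≡) ⟩
  suc (2 ^ m + 2 ^ m + below y)            ≡⟨ cong (λ t → suc (2 ^ m + t + below y)) (+-identityʳ (2 ^ m)) ⟨
  suc (2 ^ suc m + below y)                ∎
  where
  open ≡-Reasoning
  shuffle : ∀ a b c d → a + (b + c) + d ≡ a + (d + b) + c
  shuffle = solve-∀
  v = weight y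
  B = binomialSum m (suc v)
  odds  = length (concatMap (decreasing (suc m)) (oddsUpTo (suc m)))
  later = length (concatMap (increasing (suc m)) (reverse rest))
  position : Split y (sequence (suc m)) (odds + (later + below y)) _
  position = split-++ʳ (concatMap (decreasing (suc m)) (oddsUpTo (suc m)))
    (split-concatMap (increasing (suc m)) (reverse rest) v
      (trans (cong reverse eq) (reverse-++-∷ (filter (2 ∣?_) (upTo v)) v rest))
      (subst (λ l → Split y l (below y) (above y)) (sym (increasing≡ofWeight (suc m) v)) (split-ofWeight y)))
  odds≡ : odds ≡ 2 ^ m
  odds≡ = trans (length-concatMap (decreasing (suc m)) (length-decreasing (suc m)) (oddsUpTo (suc m))) (OddSum.partialSum-full m)
  later≡ : B + later ≡ 2 ^ m
  later≡ = begin
    B + later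
      ≡⟨ cong (B +_) (trans (length-concatMap (increasing (suc m)) (length-increasing (suc m)) (reverse rest)) (sum-↭ (↭-map⁺ (suc m C_) (↭-reverse rest)))) ⟩
    B + sum (map (suc m C_) rest)
      ≡⟨ cong (_+ sum (map (suc m C_) rest)) (trans (sym (proj₂ (EvenSum.partialSum≡binomialSum m v) 2∣v)) (EvenSum.partialSum-accept (suc m) 2∣v)) ⟩
    EvenSum.partialSum (suc m) v + suc m C v + sum (map (suc m C_) rest)
      ≡⟨ +-assoc (EvenSum.partialSum (suc m) v) (suc m C v) _ ⟩
    EvenSum.partialSum (suc m) v + sum (map (suc m C_) (v ∷ rest))
      ≡⟨ sum-++ (map (suc m C_) (filter (2 ∣?_) (upTo v))) (map (suc m C_) (v ∷ rest)) ⟨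
    sum (map (suc m C_) (filter (2 ∣?_) (upTo v)) ++ map (suc m C_) (v ∷ rest))
      ≡⟨ cong sum (map-++ (suc m C_) (filter (2 ∣?_) (upTo v)) (v ∷ rest)) ⟨
    sum (map (suc m C_) (filter (2 ∣?_) (upTo v) ++ v ∷ rest))
      ≡⟨ cong (sum ∘ map (suc m C_)) eq ⟨
    EvenSum.partialSum (suc m) (suc (suc m))
      ≡⟨ EvenSum.partialSum-full m ⟩
    2 ^ m ∎

-- Edges of the hypercube

infix 4 _⋖_

-- The covering relation of the Boolean lattice, orienting each edge towards the larger weight. Its
-- recursion strips common leading bits until the flipped one.
data _⋖_ : ∀ {n} → BitString n → BitString n → Set where
  flipped : ∀ {n} (z : BitString n) → false ∷ z ⋖ true ∷ z
  shared  : ∀ {n} b {v u : BitString n} → v ⋖ u → b ∷ v ⋖ b ∷ u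

⋖-weight : ∀ {n} {v u : BitString n} → v ⋖ u → weight u ≡ suc (weight v)
⋖-weight (flipped z)        = refl
⋖-weight (shared false v⋖u) = ⋖-weight v⋖u
⋖-weight (shared true v⋖u)  = cong suc (⋖-weight v⋖u)

hammingDistance-self : ∀ {n} (x : BitString n) → hammingDistance x x ≡ 0
hammingDistance-self []          = refl
hammingDistance-self (false ∷ x) = hammingDistance-self x
hammingDistance-self (true ∷ x)  = hammingDistance-self x

hammingDistance≡0⇒≡ : ∀ {n} (x y : BitString n) → hammingDistance x y ≡ 0 → x ≡ y
hammingDistance≡0⇒≡ []          []          _ = refl
hammingDistance≡0⇒≡ (false ∷ x) (false ∷ y) d = cong (false ∷_) (hammingDistance≡0⇒≡ x y d)
hammingDistance≡0⇒≡ (true ∷ x)  (true ∷ y)  d = cong (true ∷_) (hammingDistance≡0⇒≡ x y d)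

⋖⇒adjacent : ∀ {n} {v u : BitString n} → v ⋖ u → Adjacent u v
⋖⇒adjacent (flipped z)        = cong suc (hammingDistance-self z)
⋖⇒adjacent (shared false v⋖u) = ⋖⇒adjacent v⋖u
⋖⇒adjacent (shared true v⋖u)  = ⋖⇒adjacent v⋖u

adjacent⇒⋖ : ∀ {n} (x y : BitString n) → Adjacent x y → x ⋖ y ⊎ y ⋖ x
adjacent⇒⋖ []          []          ()
adjacent⇒⋖ (false ∷ x) (true ∷ y)  d with hammingDistance≡0⇒≡ x y (suc-injective d)
... | refl = inj₁ (flipped x)
adjacent⇒⋖ (true ∷ x)  (false ∷ y) d with hammingDistance≡0⇒≡ x y (suc-injective d)
... | refl = inj₂ (flipped x)
adjacent⇒⋖ (false ∷ x) (false ∷ y) d = map⊎ (shared false) (shared false) (adjacent⇒⋖ x y d)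
adjacent⇒⋖ (true ∷ x)  (true ∷ y)  d = map⊎ (shared true) (shared true) (adjacent⇒⋖ x y d)

-- Sums of `f` along edges

edge≤str : ∀ {n} (g : BitString n → ℕ) (x y : BitString n) → Adjacent x y → g x + g y ≤ str g
edge≤str {n} g x y x~y = All.lookup (xs≤max 0 (map (uncurry λ x y → g x + g y) (edges n)))
  (∈-map⁺ (uncurry λ x y → g x + g y) (∈-filter⁺ adjacent? (∈-cartesianProduct⁺ (∈-bitStrings x) (∈-bitStrings y)) x~y))

-- This is f x + f y − 2ⁿ⁺¹ for the edge of Qₙ₊₁ that arises from v ⋖ u by
-- prefixing the bit which makes the weight of the upper end odd.
excess : ∀ {n} → BitString n → BitString n → ℕ
excess u v = suc (suc (above u + below v))

-- A common 0 enlarges only `above u`, by `n C⁻ weight u`; a common 1 enlarges only `below v`, by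
-- `n C suc (weight v)`. As `weight u ≡ suc (weight v)`, both increments are entry `weight (b ∷ v)`
-- of row n.
excess-shared : ∀ {n} b {v u : BitString n} → v ⋖ u → excess (b ∷ u) (b ∷ v) ≡ n C weight (b ∷ v) + excess u v
excess-shared {n} false {v} {u} v⋖u rewrite ⋖-weight v⋖u = shuffle (above u) (n C weight v) (below v)
  where
  shuffle : ∀ a c b → suc (suc (a + c + b)) ≡ c + suc (suc (a + b))
  shuffle = solve-∀
excess-shared {n} true {v} {u} v⋖u = shuffle (above u) (n C suc (weight v)) (below v)
  where
  shuffle : ∀ a c b → suc (suc (a + (c + b))) ≡ c + suc (suc (a + b))
  shuffle = solve-∀

-- Both ranks refer to the same string z. Of the two added units, one counts z itself and completes
-- its weight class; the other remains.
excess-flipped : ∀ {n} (z : BitString n) → excess (true ∷ z) (false ∷ z) ≡ n C weight z + 1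
excess-flipped {n} z = begin
  suc (suc (above z + below z))    ≡⟨ cong (suc ∘ suc) (+-comm (above z) (below z)) ⟩
  suc (suc (below z + above z))    ≡⟨ cong suc (suc[below+above]≡nC[weight] z) ⟩
  suc (n C weight z)               ≡⟨ +-comm 1 (n C weight z) ⟩
  n C weight z + 1                 ∎
  where open ≡-Reasoning

-- `f-odd` contains `binomialSum m (weight y)` and `f-even` the same sum with one further entry, so
-- adding them cancels all but `m C weight y`.
f-edge : ∀ {m} {y x : BitString (suc m)} → y ⋖ x → 2 ∣ weight y →
  f (suc m) x + f (suc m) y + m C weight y ≡ 2 ^ suc m + excess x y
f-edge {m} {y} {x} y⋖x 2∣v = +-cancelˡ-≡ B _ _ (begin
  B + (f (suc m) x + f (suc m) y + m C weight y)      ≡⟨ shuffle B (f (suc m) x) (f (suc m) y) (m C weight y) ⟩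
  f (suc m) x + (f (suc m) y + (B + m C weight y))    ≡⟨ cong₂ _+_ (f-odd x (⋖-weight y⋖x) 2∣v) (f-even y 2∣v) ⟩
  suc (B + above x) + suc (2 ^ suc m + below y)       ≡⟨ shuffle′ B (above x) (2 ^ suc m) (below y) ⟩
  B + (2 ^ suc m + excess x y)                        ∎)
  where
  open ≡-Reasoning
  B = binomialSum m (weight y)
  shuffle : ∀ b p q c → b + (p + q + c) ≡ p + (q + (b + c))
  shuffle = solve-∀
  shuffle′ : ∀ b a t c → suc (b + a) + suc (t + c) ≡ b + (t + suc (suc (a + c)))
  shuffle′ = solve-∀

-- The entry left over in `f-edge` is exactly the growth of the excess caused by the shared bit, so
-- only the excess of the shorter edge remains.
f-edge-shared : ∀ {m} b {v u : BitString m} → v ⋖ u → 2 ∣ weight (b ∷ v) →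
  f (suc m) (b ∷ u) + f (suc m) (b ∷ v) ≡ 2 ^ suc m + excess u v
f-edge-shared {m} b {v} {u} v⋖u 2∣ = +-cancelʳ-≡ (m C weight (b ∷ v)) _ _ (begin
  f (suc m) (b ∷ u) + f (suc m) (b ∷ v) + m C weight (b ∷ v)    ≡⟨ f-edge (shared b v⋖u) 2∣ ⟩
  2 ^ suc m + excess (b ∷ u) (b ∷ v)                            ≡⟨ cong (2 ^ suc m +_) (excess-shared b v⋖u) ⟩
  2 ^ suc m + (m C weight (b ∷ v) + excess u v)                 ≡⟨ shuffle (2 ^ suc m) (m C weight (b ∷ v)) (excess u v) ⟩
  2 ^ suc m + excess u v + m C weight (b ∷ v)                   ∎)
  where
  open ≡-Reasoning
  shuffle : ∀ t c e → t + (c + e) ≡ t + e + c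
  shuffle = solve-∀

-- From edges of Qₙ₋₂ to edges of Qₙ

excess≤str : ∀ {m} {v u : BitString m} → v ⋖ u → 2 ^ suc m + excess u v ≤ str (f (suc m))
excess≤str {m} {v} {u} v⋖u with 2 ∣? weight v
-- The prefixed bit makes the weight of the lower end even, so `f-edge-shared` applies to every
-- edge.
... | yes 2∣v = subst (_≤ str (f (suc m))) (f-edge-shared false v⋖u 2∣v)
                  (edge≤str (f (suc m)) (false ∷ u) (false ∷ v) (⋖⇒adjacent (shared false v⋖u)))
... | no odd  = subst (_≤ str (f (suc m))) (f-edge-shared true v⋖u (2∣-step (weight v) odd))
                  (edge≤str (f (suc m)) (true ∷ u) (true ∷ v) (⋖⇒adjacent (shared true v⋖u)))

-- Every edge has positive excess; one at the all-zero string serves as witness. The strictness is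
-- what `excess-step` requires.
2^n<str : ∀ m → 2 ^ suc (suc m) < str (f (suc (suc m)))
2^n<str m = <-≤-trans (m<m+n (2 ^ suc (suc m)) z<s) (excess≤str (flipped (replicate m false)))

-- A bound s − t on the excess, without subtraction.
ExcessBound : ℕ → ℕ → ℕ → Set
ExcessBound n t s = ∀ {v u : BitString n} → v ⋖ u → t + excess u v ≤ s

-- A shared bit costs one entry of row n, at most the central one. If the first bit is the flipped
-- one, no shorter edge is left and the excess is an entry of row n plus 1; `t < s` absorbs that 1.
excess-step : ∀ {n t s} → t < s → ExcessBound n t s → ExcessBound (suc n) t (n C ⌈ n /2⌉ + s)
excess-step {n} {t} {s} t<s bound (flipped z) = begin
  t + excess (true ∷ z) (false ∷ z)    ≡⟨ cong (t +_) (excess-flipped z) ⟩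
  t + (n C weight z + 1)               ≡⟨ shuffle t (n C weight z) ⟩
  n C weight z + suc t                 ≤⟨ +-mono-≤ (nCk≤nC⌈n/2⌉ n (weight z)) t<s ⟩
  n C ⌈ n /2⌉ + s                      ∎
  where
  open ≤-Reasoning
  shuffle : ∀ t c → t + (c + 1) ≡ c + suc t
  shuffle = solve-∀
excess-step {n} {t} {s} t<s bound (shared b {v} {u} v⋖u) = begin
  t + excess (b ∷ u) (b ∷ v)                  ≡⟨ cong (t +_) (excess-shared b v⋖u) ⟩
  t + (n C weight (b ∷ v) + excess u v)       ≡⟨ shuffle t (n C weight (b ∷ v)) (excess u v) ⟩
  n C weight (b ∷ v) + (t + excess u v)       ≤⟨ +-mono-≤ (nCk≤nC⌈n/2⌉ n (weight (b ∷ v))) (bound v⋖u) ⟩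
  n C ⌈ n /2⌉ + s                             ∎
  where
  open ≤-Reasoning
  shuffle : ∀ t c e → t + (c + e) ≡ c + (t + e)
  shuffle = solve-∀

-- The leading 1 places true ∷ x among the first m C weight x strings of its
-- weight, which is what keeps these sums at most 2ᵐ⁺¹.
f-edge-odd-lower : ∀ {m} {x y : BitString m} → x ⋖ y → 2 ∣ weight x →
  f (suc m) (true ∷ x) + f (suc m) (true ∷ y) ≤ 2 ^ suc m
f-edge-odd-lower {m} {x} {y} x⋖y 2∣u = +-cancelˡ-≤ R _ _ (begin
  R + (f (suc m) (true ∷ x) + f (suc m) (true ∷ y))                        ≡⟨ shuffle B (m C u) (m C suc u) (m C suc (suc u)) (f (suc m) (true ∷ x)) (f (suc m) (true ∷ y)) ⟩
  f (suc m) (true ∷ x) + (f (suc m) (true ∷ y) + R)                        ≡⟨ cong₂ _+_ (f-odd (true ∷ x) refl 2∣u) f-y ⟩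
  suc (B + above x) + suc (2 ^ suc m + below (true ∷ y))                   ≡⟨ shuffle′ B (above x) (2 ^ suc m) (below (true ∷ y)) ⟩
  B + suc (above x) + suc (below (true ∷ y)) + 2 ^ suc m                   ≤⟨ +-monoˡ-≤ (2 ^ suc m) (+-mono-≤ (+-monoʳ-≤ B above<) below<) ⟩
  B + m C u + (m C suc u + m C suc (suc u)) + 2 ^ suc m                    ≡⟨ cong (_+ 2 ^ suc m) (+-assoc (B + m C u) (m C suc u) _) ⟨
  R + 2 ^ suc m                                                            ∎)
  where
  open ≤-Reasoning
  u = weight x
  B = binomialSum m u
  -- The sum that `f-even` adds for weight u + 2: `B` and three further entries, the first to absorb
  -- `above x`, the other two to absorb `below (true ∷ y)`.
  R = binomialSum m (suc (suc (suc u)))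
  shuffle : ∀ b c d e p q → b + c + d + e + (p + q) ≡ p + (q + (b + c + d + e))
  shuffle = solve-∀
  shuffle′ : ∀ b a t c → suc (b + a) + suc (t + c) ≡ b + suc a + suc c + t
  shuffle′ = solve-∀
  f-y : f (suc m) (true ∷ y) + R ≡ suc (2 ^ suc m + below (true ∷ y))
  f-y = subst (λ w → f (suc m) (true ∷ y) + binomialSum m (suc (suc w)) ≡ suc (2 ^ suc m + below (true ∷ y))) (⋖-weight x⋖y)
    (f-even (true ∷ y) (subst (2 ∣_) (cong suc (sym (⋖-weight x⋖y))) (∣m∣n⇒∣m+n ∣-refl 2∣u)))
  above< : suc (above x) ≤ m C u
  above< = ≤-trans (s≤s (m≤n+m (above x) (below x))) (≤-reflexive (suc[below+above]≡nC[weight] x))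
  below< : suc (below (true ∷ y)) ≤ m C suc u + m C suc (suc u)
  below< = begin
    suc (below (true ∷ y))                         ≤⟨ s≤s (m≤m+n (below (true ∷ y)) (above y)) ⟩
    suc (below (true ∷ y) + above y)               ≡⟨ suc[below+above]≡nC[weight] (true ∷ y) ⟩
    suc m C suc (weight y)                         ≡⟨ cong (λ w → suc m C suc w) (⋖-weight x⋖y) ⟩
    suc m C suc (suc u)                            ≡⟨ nCk+nC[k+1]≡[n+1]C[k+1] m (suc u) ⟨
    m C suc u + m C suc (suc u)                    ∎

-- The right-hand side of the theorem for n = m + 3, free of subtraction.
strBound : ℕ → ℕ
strBound m = str (f (suc m)) + 3 * 2 ^ suc m + m C ⌈ m /2⌉ + suc m C ⌈ suc m /2⌉

f-edge-ones : ∀ m {y x : BitString (3 + m)} → y ⋖ x →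
  f (4 + m) (true ∷ x) + f (4 + m) (true ∷ y) ≤ strBound (suc m)
f-edge-ones m {y} {x} y⋖x with 2 ∣? weight y
-- Prefixing 1 turns the even weight of the lower end odd.
... | yes 2∣v = begin
  f (4 + m) (true ∷ x) + f (4 + m) (true ∷ y)    ≡⟨ +-comm (f (4 + m) (true ∷ x)) _ ⟩
  f (4 + m) (true ∷ y) + f (4 + m) (true ∷ x)    ≤⟨ f-edge-odd-lower y⋖x 2∣v ⟩
  -- With n = m + 4, one of the four copies of 2ⁿ⁻² in 2ⁿ is compared with `str`; the others give
  -- the term 3 · 2ⁿ⁻².
  2 ^ (4 + m)                                    ≡⟨ quadruple (2 ^ (2 + m)) ⟩
  2 ^ (2 + m) + 3 * 2 ^ (2 + m)                  ≤⟨ +-monoˡ-≤ (3 * 2 ^ (2 + m)) (<⇒≤ (2^n<str m)) ⟩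
  str (f (2 + m)) + 3 * 2 ^ (2 + m)              ≤⟨ ≤-trans (m≤m+n _ _) (m≤m+n _ _) ⟩
  strBound (suc m)                               ∎
  where
  open ≤-Reasoning
  quadruple : ∀ t → 2 * (2 * t) ≡ t + 3 * t
  quadruple = solve-∀
... | no odd = begin
  f (4 + m) (true ∷ x) + f (4 + m) (true ∷ y)       ≡⟨ f-edge-shared true y⋖x (2∣-step (weight y) odd) ⟩
  2 ^ (4 + m) + excess x y                          ≡⟨ quadruple (2 ^ (2 + m)) (excess x y) ⟩
  2 ^ (2 + m) + excess x y + 3 * 2 ^ (2 + m)        ≤⟨ +-monoˡ-≤ (3 * 2 ^ (2 + m)) excess≤ ⟩
  c₂ + (c₁ + str (f (2 + m))) + 3 * 2 ^ (2 + m)     ≡⟨ shuffle c₂ c₁ (str (f (2 + m))) (3 * 2 ^ (2 + m)) ⟩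
  strBound (suc m)                                  ∎
  where
  open ≤-Reasoning
  c₁ = suc m C ⌈ suc m /2⌉
  c₂ = suc (suc m) C ⌈ suc (suc m) /2⌉
  quadruple : ∀ t e → 2 * (2 * t) + e ≡ t + e + 3 * t
  quadruple = solve-∀
  shuffle : ∀ a b s t → a + (b + s) + t ≡ s + t + b + a
  shuffle = solve-∀
  excess≤ : 2 ^ (2 + m) + excess x y ≤ c₂ + (c₁ + str (f (2 + m)))
  -- Rows m + 1 and m + 2 enter as edges grow from length m + 1 to m + 3. Adding `c₁` keeps the
  -- strict inequality needed for the second step.
  excess≤ = excess-step (≤-trans (2^n<str m) (m≤n+m _ c₁)) (excess-step (2^n<str m) excess≤str) y⋖x

theorem2p5 : (n : ℕ) → n ≥ 5 → Odd n → (x y : BitString n) → Adjacent x y → f n x + f n y ≡ str (f n) → BeginsWith true x → BeginsWith true y → str (f n) ≤ str (f (n ∸ 2)) + 3 * 2 ^ (n ∸ 2) + (n ∸ 3) C ⌈ n ∸ 3 /2⌉ + (n ∸ 2) C ⌈ n ∸ 2 /2⌉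
theorem2p5 (suc (suc (suc (suc m)))) (s≤s (s≤s (s≤s (s≤s _)))) _ (true ∷ x) (true ∷ y) x~y attained refl refl
  with adjacent⇒⋖ x y x~y
... | inj₁ x⋖y = subst (_≤ strBound (suc m)) (trans (+-comm (f (4 + m) (true ∷ y)) (f (4 + m) (true ∷ x))) attained) (f-edge-ones m x⋖y)
... | inj₂ y⋖x = subst (_≤ strBound (suc m)) attained (f-edge-ones m y⋖x)
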